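{- The expected runtime of Quick LOHify on an array of $n$ elements is in $\Theta(n)$.
   Context: Quick LOHify: given an array of $n$ mutually comparable (distinct) values, partition the array about a uniformly random element, record the resulting index of this element in an auxiliary array (constant time per recursion), and then recurse on the left side (the elements smaller than the partitioning element), until the best (smallest) element is selected. The recorded indices delimit layers $L_0\le L_1\le\cdots$. Partitioning $m$ elements costs a number of comparisons linear in $m$. The expectation is over the random choices, and the runtime is measured (up to constant factors) by the number of comparisons. Asymptotics are as $n\to\infty$. -}

module Defs where

import Algebra.Properties.CommutativeMonoid.Sum
open import Data.Bool using (Bool; true; false)
open import Data.Fin as Fin using (Fin; toℕ; fromℕ<; inject)
open import Data.Fin.Permutation using (Permutation′; _⟨$⟩ʳ_)
open import Data.Fin.Properties using (toℕ<n)
open import Data.Integer using (+_)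
open import Data.List using (List; []; _∷_)
open import Data.Nat as ℕ using (ℕ; zero; suc; NonZero)
open import Data.Nat.Induction using (Acc; acc; <-wellFounded)
open import Data.Product using (Σ; ∃-syntax; _×_; _,_; proj₁; proj₂)
open import Data.Rational as ℚ using (ℚ; 0ℚ; _/_)
open import Data.Rational.Properties using (+-0-commutativeMonoid)
open import Data.Vec.Functional using (Vector)
open import Function using (_∘_)
open import Function.Definitions using (Injective)
open import Level using (Level; _⊔_)
open import Relation.Binary.Bundles using (StrictTotalOrder)
open import Relation.Binary.PropositionalEquality using (_≡_)
open import Relation.Nullary using (does; yes; no)

open Algebra.Properties.CommutativeMonoid.Sum +-0-commutativeMonoid using (sum)

private
  variable
    a b ℓ₁ ℓ₂ : Level
    A : Set a
    B : Set b
    m n : ℕ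

fromℕ : ℕ → ℚ
fromℕ n = + n / 1

-- A quantity f may depend on the whole input, not only on its size n; the
-- constants are uniform over all inputs X n of size n.  No absolute values
-- appear because Θ is only used with nonnegative quantities.
_∈Θ_ : {X : ℕ → Set a} → (∀ n → X n → ℚ) → (ℕ → ℚ) → Set a
_∈Θ_ {X = X} f g =
  ∃[ c₁ ] ∃[ c₂ ] ∃[ n₀ ] (0ℚ ℚ.< c₁) × (0ℚ ℚ.< c₂) ×
    (∀ n → n₀ ℕ.≤ n → (x : X n) →
      (c₁ ℚ.* g n ℚ.≤ f n x) × (f n x ℚ.≤ c₂ ℚ.* g n))

-- Finite probabilistic computations: uniform n k draws i from Fin n uniformly,
-- independently of all other draws, and continues with k i.
data Random (B : Set b) : Set b where
  return  : B → Random B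
  uniform : (n : ℕ) .{{_ : NonZero n}} → (Fin n → Random B) → Random B

mapᴿ : (A → B) → Random A → Random B
mapᴿ f (return x)    = return (f x)
mapᴿ f (uniform n k) = uniform n (λ i → mapᴿ f (k i))

𝔼 : (B → ℚ) → Random B → ℚ
𝔼 f (return x)    = f x
𝔼 f (uniform n k) = (+ 1 / n) ℚ.* sum (λ i → 𝔼 f (k i))

-- Comparison-based procedures on an array of length m, as decision trees.  They
-- have access to the array only through queries: query j k asks whether
-- the entry at position j is smaller than the entry at position k.
data Comparing (m : ℕ) (B : Set b) : Set b where
  return : B → Comparing m B
  query : (j k : Fin m) → (Bool → Comparing m B) → Comparing m B

-- The rearranged array has at position j the entry formerly at position
-- rearrangement ⟨$⟩ʳ j; the pivot ends up at position index.
record Partition (m : ℕ) : Set where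
  field
    rearrangement : Permutation′ m
    index         : Fin m

PartitionProcedure : Set
PartitionProcedure = ∀ m → (pivot : Fin m) → Comparing m (Partition m)

record Outcome (A : Set a) (n : ℕ) : Set a where
  field
    array       : Vector A n
    indices     : List ℕ
    comparisons : ℕ

module _ (O : StrictTotalOrder a ℓ₁ ℓ₂) where
  open StrictTotalOrder O

  DistinctArray : ℕ → Set (a ⊔ ℓ₁)
  DistinctArray n = Σ (Vector Carrier n) (Injective _≡_ _≈_)

  -- The result of the procedure together with the number of comparisons made.
  run : Vector Carrier m → Comparing m B → B × ℕ
  run xs (return x)      = x , 0
  run xs (query j k t) =
    let x , c = run xs (t (does (xs j <? xs k))) in x , suc c

  record IsPartition (xs : Vector Carrier m) (pivot : Fin m)
                     (p : Partition m) : Set ℓ₂ where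
    open Partition p
    field
      placed  : rearrangement ⟨$⟩ʳ index ≡ pivot
      smaller : ∀ j → j Fin.< index → xs (rearrangement ⟨$⟩ʳ j) < xs pivot
      larger  : ∀ j → index Fin.< j → xs pivot < xs (rearrangement ⟨$⟩ʳ j)

  Correct : PartitionProcedure → Set (a ⊔ ℓ₁ ⊔ ℓ₂)
  Correct partition = ∀ m ((xs , _) : DistinctArray m) (pivot : Fin m) →
    IsPartition xs pivot (proj₁ (run xs (partition m pivot)))

  partitionComparisons : PartitionProcedure →
                         ∀ m → DistinctArray m × Fin m → ℚ
  partitionComparisons partition m ((xs , _) , pivot) =
    fromℕ (proj₂ (run xs (partition m pivot)))

  -- The smallest element has been selected exactly when index is zero, and
  -- then the recursive call is on the empty array and stops.  Since the left
  -- part is a prefix, an index within it is also an index of the full array.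
  lohify : PartitionProcedure → Acc ℕ._<_ n → Vector Carrier n →
           Random (Outcome Carrier n)
  lohify {zero}  partition _         xs = return record
    { array = xs ; indices = [] ; comparisons = 0 }
  lohify {suc n} partition (acc rec) xs = uniform (suc n) λ pivot →
    let p , c = run xs (partition (suc n) pivot)
        open Partition p
        ys : Vector Carrier (suc n)
        ys = xs ∘ (rearrangement ⟨$⟩ʳ_)
        left : Vector Carrier (toℕ index)
        left = ys ∘ inject
        finish : Outcome Carrier (toℕ index) → Outcome Carrier (suc n)
        finish r = record
          { array       = writeBack index (Outcome.array r) ys
          ; indices     = toℕ index ∷ Outcome.indices r
          ; comparisons = c ℕ.+ Outcome.comparisons r
          }
    in mapᴿ finish (lohify partition (rec (toℕ<n index)) left)
    where
    writeBack : (i : Fin m) → Vector A (toℕ i) → Vector A m → Vector A m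
    writeBack i left ys j with j Fin.<? i
    ... | yes j<i = left (fromℕ< j<i)
    ... | no  _   = ys j

  quickLOHify : PartitionProcedure → Vector Carrier n →
                Random (Outcome Carrier n)
  quickLOHify partition = lohify partition (<-wellFounded _)

  expectedRuntime : PartitionProcedure → ∀ n → DistinctArray n → ℚ
  expectedRuntime partition _ (xs , _) =
    𝔼 (fromℕ ∘ Outcome.comparisons) (quickLOHify partition xs)

{-# OPTIONS --safe #-}

-- The first partition alone gives the lower bound.  For the upper bound, suppose
-- partitioning m elements costs at most K m.  The pivot ends up at an index which
-- is at most the number of smaller elements, and of any two elements at most one
-- is smaller than the other, so the indices of the m possible pivots add up to at
-- most m²/2.  If T(k) ≤ 2 K k for all k < m, averaging over the pivot then gives
-- T(m) ≤ K m + 2 K (m²/2) / m = 2 K m.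

module Submission where

open import Algebra.Bundles using (CommutativeRing)
import Algebra.Properties.Semiring.Sum
open import Data.Bool using (true; false; if_then_else_)
open import Data.Fin as Fin using (Fin; toℕ; fromℕ<; inject; zero; suc)
open import Data.Fin.Permutation using (_⟨$⟩ʳ_)
open import Data.Fin.Properties using (toℕ<n; toℕ-fromℕ<; toℕ-inject; toℕ-injective)
import Data.Integer as ℤ
import Data.Integer.Properties as ℤ
open import Data.Integer using (+_)
open import Data.Nat as ℕ using (ℕ; zero; suc; NonZero; z≤n; s≤s)
import Data.Nat.Properties as ℕ
open import Data.Nat.Induction using (Acc; acc; <-wellFounded)
open import Data.Product using (Σ; _×_; _,_; proj₁; proj₂)
open import Data.Rational as ℚ using (ℚ; 0ℚ; 1ℚ; _/_; _+_; _*_; _≤_; NonNegative)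
import Data.Rational.Properties as ℚ
open import Data.Rational.Solver using (module +-*-Solver)
import Data.Rational.Unnormalised as ℚᵘ
import Data.Rational.Unnormalised.Properties as ℚᵘ
open import Data.Vec.Functional using (Vector)
open import Defs
open import Function using (_∘_)
open import Function.Bundles using (Injection)
open import Function.Definitions using (Injective)
open import Function.Properties.Inverse using (↔⇒↣)
open import Level using (Level)
open import Relation.Binary.Bundles using (StrictTotalOrder)
open import Relation.Binary.PropositionalEquality
  using (_≡_; refl; sym; trans; cong; cong₂)
open import Relation.Nullary using (does; yes; no; contradiction)
open import Relation.Nullary.Decidable using (dec-true)

open Algebra.Properties.Semiring.Sum ℕ.+-*-semiring using ()
  renaming (sum to sumℕ; ∑-distrib-+ to sumℕ-distrib-+; ∑-comm to sumℕ-comm;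
            sum-permute to sumℕ-permute; sum-cong-≗ to sumℕ-cong)
open Algebra.Properties.Semiring.Sum (CommutativeRing.semiring ℚ.+-*-commutativeRing)
  using (sum; sum-cong-≗; ∑-distrib-+; *-distribˡ-sum)
open +-*-Solver using (solve; _:=_; _:+_; _:*_; con)

private
  variable
    a b ℓ₁ ℓ₂ : Level
    A : Set a
    B : Set b
    m n : ℕ

-- Embedding the naturals into the rationals.

toℚᵘ-fromℕ : ∀ n → ℚ.toℚᵘ (fromℕ n) ℚᵘ.≃ ℚᵘ.mkℚᵘ (+ n) 0
toℚᵘ-fromℕ n = ℚ.toℚᵘ-fromℚᵘ (ℚᵘ.mkℚᵘ (+ n) 0)

-- Since `_/_` cancels a gcd, the identity is checked on unnormalised fractions, where numerators
-- and denominators are explicit, and transported back by `toℚᵘ-injective`.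
fromℕ-+ : ∀ m n → fromℕ (m ℕ.+ n) ≡ fromℕ m + fromℕ n
fromℕ-+ m n = ℚ.toℚᵘ-injective (begin-equality
  ℚ.toℚᵘ (fromℕ (m ℕ.+ n))
    ≃⟨ toℚᵘ-fromℕ (m ℕ.+ n) ⟩
  ℚᵘ.mkℚᵘ (+ (m ℕ.+ n)) 0
    ≃⟨ ℚᵘ.*≡* (cong (ℤ._* + 1) (sym (cong₂ ℤ._+_ (ℤ.*-identityʳ (+ m)) (ℤ.*-identityʳ (+ n))))) ⟩
  ℚᵘ.mkℚᵘ (+ m) 0 ℚᵘ.+ ℚᵘ.mkℚᵘ (+ n) 0
    ≃⟨ ℚᵘ.+-cong (toℚᵘ-fromℕ m) (toℚᵘ-fromℕ n) ⟨
  ℚ.toℚᵘ (fromℕ m) ℚᵘ.+ ℚ.toℚᵘ (fromℕ n)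
    ≃⟨ ℚ.toℚᵘ-homo-+ (fromℕ m) (fromℕ n) ⟨
  ℚ.toℚᵘ (fromℕ m + fromℕ n) ∎)
  where open ℚᵘ.≤-Reasoning

fromℕ-* : ∀ m n → fromℕ (m ℕ.* n) ≡ fromℕ m * fromℕ n
fromℕ-* zero    n = sym (ℚ.*-zeroˡ (fromℕ n))
fromℕ-* (suc m) n = begin-equality
  fromℕ (n ℕ.+ m ℕ.* n)          ≡⟨ fromℕ-+ n (m ℕ.* n) ⟩
  fromℕ n + fromℕ (m ℕ.* n)      ≡⟨ cong (λ x → fromℕ n + x) (fromℕ-* m n) ⟩
  fromℕ n + fromℕ m * fromℕ n    ≡⟨ solve 2 (λ x y → x :+ y :* x := (con 1ℚ :+ y) :* x) refl (fromℕ n) (fromℕ m) ⟩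
  (1ℚ + fromℕ m) * fromℕ n       ≡⟨ cong (_* fromℕ n) (fromℕ-+ 1 m) ⟨
  fromℕ (suc m) * fromℕ n        ∎
  where open ℚ.≤-Reasoning

fromℕ-nonNegative : ∀ n → NonNegative (fromℕ n)
fromℕ-nonNegative n = ℚ.normalize-nonNeg n 1

p≤p+q : ∀ p q .{{_ : NonNegative q}} → p ≤ p + q
p≤p+q p q = ℚ.≤-trans (ℚ.≤-reflexive (sym (ℚ.+-identityʳ p)))
                      (ℚ.+-monoʳ-≤ p (ℚ.nonNegative⁻¹ q))

fromℕ-mono-≤ : m ℕ.≤ n → fromℕ m ≤ fromℕ n
fromℕ-mono-≤ {m} {n} m≤n = begin
  fromℕ m                     ≤⟨ p≤p+q (fromℕ m) (fromℕ (n ℕ.∸ m)) ⟩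
  fromℕ m + fromℕ (n ℕ.∸ m)   ≡⟨ fromℕ-+ m (n ℕ.∸ m) ⟨
  fromℕ (m ℕ.+ (n ℕ.∸ m))     ≡⟨ cong fromℕ (ℕ.m+[n∸m]≡n m≤n) ⟩
  fromℕ n                     ∎
  where
  open ℚ.≤-Reasoning
  instance _ = fromℕ-nonNegative (n ℕ.∸ m)

1/n*fromℕ-n : ∀ n .{{_ : NonZero n}} → (+ 1 / n) * fromℕ n ≡ 1ℚ
1/n*fromℕ-n n@(suc n-1) = ℚ.toℚᵘ-injective (begin-equality
  ℚ.toℚᵘ ((+ 1 / n) * fromℕ n)
    ≃⟨ ℚ.toℚᵘ-homo-* (+ 1 / n) (fromℕ n) ⟩
  ℚ.toℚᵘ (+ 1 / n) ℚᵘ.* ℚ.toℚᵘ (fromℕ n)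
    ≃⟨ ℚᵘ.*-cong (ℚ.toℚᵘ-fromℚᵘ (ℚᵘ.mkℚᵘ (+ 1) n-1)) (toℚᵘ-fromℕ n) ⟩
  ℚᵘ.mkℚᵘ (+ 1) n-1 ℚᵘ.* ℚᵘ.mkℚᵘ (+ n) 0
    ≃⟨ ℚᵘ.*≡* (trans (ℤ.*-identityʳ _) (cong (λ k → + 1 ℤ.* k) (sym (ℤ.*-identityʳ (+ n))))) ⟩
  ℚᵘ.1ℚᵘ ∎)
  where open ℚᵘ.≤-Reasoning

-- Finite sums and means of rationals.

sum-mono-≤ : {f g : Vector ℚ n} → (∀ i → f i ≤ g i) → sum f ≤ sum g
sum-mono-≤ {zero}  f≤g = ℚ.≤-refl
sum-mono-≤ {suc n} f≤g = ℚ.+-mono-≤ (f≤g zero) (sum-mono-≤ (f≤g ∘ suc))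

sum-fromℕ : (f : Vector ℕ n) → sum (fromℕ ∘ f) ≡ fromℕ (sumℕ f)
sum-fromℕ {zero}  f = refl
sum-fromℕ {suc n} f = trans (cong (λ x → fromℕ (f zero) + x) (sum-fromℕ (f ∘ suc)))
                            (sym (fromℕ-+ (f zero) _))

sum-const : ∀ n c → sum {n} (λ _ → c) ≡ fromℕ n * c
sum-const zero    c = sym (ℚ.*-zeroˡ c)
sum-const (suc n) c = begin-equality
  c + sum {n} (λ _ → c)   ≡⟨ cong (λ x → c + x) (sum-const n c) ⟩
  c + fromℕ n * c         ≡⟨ solve 2 (λ x y → x :+ y :* x := (con 1ℚ :+ y) :* x) refl c (fromℕ n) ⟩
  (1ℚ + fromℕ n) * c      ≡⟨ cong (_* c) (fromℕ-+ 1 n) ⟨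
  fromℕ (suc n) * c       ∎
  where open ℚ.≤-Reasoning

-- Shaped so that `𝔼 f (uniform n k)` unfolds to `mean (λ i → 𝔼 f (k i))`; laws of means then apply
-- to expectations directly.
mean : .{{_ : NonZero n}} → Vector ℚ n → ℚ
mean {n} f = (+ 1 / n) * sum f

module _ .{{_ : NonZero n}} where
  open ℚ.≤-Reasoning

  mean-mono-≤ : {f g : Vector ℚ n} → (∀ i → f i ≤ g i) → mean f ≤ mean g
  mean-mono-≤ f≤g = ℚ.*-monoˡ-≤-nonNeg (+ 1 / n) (sum-mono-≤ f≤g)
    where instance _ = ℚ.normalize-nonNeg 1 n

  mean-const : ∀ c → mean {n} (λ _ → c) ≡ c
  mean-const c = begin-equality
    (+ 1 / n) * sum {n} (λ _ → c)   ≡⟨ cong ((+ 1 / n) *_) (sum-const n c) ⟩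
    (+ 1 / n) * (fromℕ n * c)       ≡⟨ ℚ.*-assoc (+ 1 / n) (fromℕ n) c ⟨
    (+ 1 / n) * fromℕ n * c         ≡⟨ cong (_* c) (1/n*fromℕ-n n) ⟩
    1ℚ * c                          ≡⟨ ℚ.*-identityˡ c ⟩
    c                               ∎

  mean-+ : (f g : Vector ℚ n) → mean (λ i → f i + g i) ≡ mean f + mean g
  mean-+ f g = trans (cong ((+ 1 / n) *_) (∑-distrib-+ f g))
                     (ℚ.*-distribˡ-+ (+ 1 / n) (sum f) (sum g))

  mean-const-+ : ∀ c (f : Vector ℚ n) → mean (λ i → c + f i) ≡ c + mean f
  mean-const-+ c f = trans (mean-+ (λ _ → c) f) (cong (_+ mean f) (mean-const c))

  mean-* : ∀ c (f : Vector ℚ n) → mean (λ i → c * f i) ≡ c * mean f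
  mean-* c f = begin-equality
    (+ 1 / n) * sum (λ i → c * f i)   ≡⟨ cong ((+ 1 / n) *_) (*-distribˡ-sum c f) ⟨
    (+ 1 / n) * (c * sum f)           ≡⟨ solve 3 (λ x y z → x :* (y :* z) := y :* (x :* z)) refl (+ 1 / n) c (sum f) ⟩
    c * ((+ 1 / n) * sum f)           ∎

-- Expectations of random computations.

𝔼-mapᴿ-+ : ∀ {f : B → ℚ} {g : A → B} {h : A → ℚ} c → (∀ x → f (g x) ≡ c + h x) →
           ∀ r → 𝔼 f (mapᴿ g r) ≡ c + 𝔼 h r
𝔼-mapᴿ-+ c eq (return x)    = eq x
𝔼-mapᴿ-+ {h = h} c eq (uniform n k) =
  -- The weights of a draw sum to one, so `c` is counted once however many draws follow.
  trans (cong ((+ 1 / n) *_) (sum-cong-≗ (λ i → 𝔼-mapᴿ-+ c eq (k i))))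
        (mean-const-+ c (λ i → 𝔼 h (k i)))

-- The type `A i` depends on the draw because the length of the left part depends on the pivot.
𝔼-uniform-mapᴿ-+ :
  .{{_ : NonZero n}} {A : Fin n → Set a} {f : B → ℚ} {g : ∀ i → A i → B} {h : ∀ i → A i → ℚ}
  (c : Vector ℚ n) → (∀ i x → f (g i x) ≡ c i + h i x) → (r : ∀ i → Random (A i)) →
  𝔼 f (uniform n (λ i → mapᴿ (g i) (r i))) ≡ mean (λ i → c i + 𝔼 (h i) (r i))
𝔼-uniform-mapᴿ-+ {n} c eq r =
  cong ((+ 1 / n) *_) (sum-cong-≗ (λ i → 𝔼-mapᴿ-+ (c i) (eq i) (r i)))

𝔼-nonNegative : ∀ {f : B → ℚ} → (∀ x → 0ℚ ≤ f x) → ∀ r → 0ℚ ≤ 𝔼 f r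
𝔼-nonNegative 0≤f (return x)    = 0≤f x
𝔼-nonNegative {f = f} 0≤f (uniform n k) = begin
  0ℚ                         ≡⟨ mean-const {n} 0ℚ ⟨
  mean {n} (λ _ → 0ℚ)        ≤⟨ mean-mono-≤ (λ i → 𝔼-nonNegative 0≤f (k i)) ⟩
  mean (λ i → 𝔼 f (k i))     ∎
  where open ℚ.≤-Reasoning

-- Finite sums of naturals, used for counting.

sumℕ-mono-≤ : {f g : Vector ℕ n} → (∀ i → f i ℕ.≤ g i) → sumℕ f ℕ.≤ sumℕ g
sumℕ-mono-≤ {zero}  f≤g = z≤n
sumℕ-mono-≤ {suc n} f≤g = ℕ.+-mono-≤ (f≤g zero) (sumℕ-mono-≤ (f≤g ∘ suc))

sumℕ-const : ∀ n c → sumℕ {n} (λ _ → c) ≡ n ℕ.* c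
sumℕ-const zero    c = refl
sumℕ-const (suc n) c = cong (c ℕ.+_) (sumℕ-const n c)

term≤sumℕ : (f : Vector ℕ n) (i : Fin n) → f i ℕ.≤ sumℕ f
term≤sumℕ f zero    = ℕ.m≤m+n _ _
term≤sumℕ f (suc i) = ℕ.≤-trans (term≤sumℕ (f ∘ suc) i) (ℕ.m≤n+m _ _)

-- Exactly `toℕ i` positions precede `i`, and each contributes at least one to the sum.
toℕ≤sumℕ : (f : Vector ℕ n) (i : Fin n) → (∀ j → j Fin.< i → 1 ℕ.≤ f j) → toℕ i ℕ.≤ sumℕ f
toℕ≤sumℕ f zero    pos = z≤n
toℕ≤sumℕ f (suc i) pos =
  ℕ.+-mono-≤ (pos zero (s≤s z≤n)) (toℕ≤sumℕ (f ∘ suc) i (λ j j<i → pos (suc j) (s≤s j<i)))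

-- Worst-case cost of a decision tree.

depth : Comparing m B → ℕ
depth (return _)    = 0
depth (query _ _ t) = suc (depth (t true) ℕ.⊔ depth (t false))

module _ (O : StrictTotalOrder a ℓ₁ ℓ₂) where
  open StrictTotalOrder O using (Carrier; _≈_; _<_; _<?_; asym)

  -- A run follows a single branch, whatever the answers are; the bound is therefore uniform over
  -- all arrays of a fixed size.
  run≤depth : (xs : Vector Carrier m) (t : Comparing m B) → proj₂ (run O xs t) ℕ.≤ depth t
  run≤depth xs (return _)    = z≤n
  run≤depth xs (query j k t) with does (xs j <? xs k)
  ... | true  = s≤s (ℕ.≤-trans (run≤depth xs (t true)) (ℕ.m≤m⊔n _ _))
  ... | false = s≤s (ℕ.≤-trans (run≤depth xs (t false)) (ℕ.m≤n⊔m (depth (t true)) _))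

  -- Ranks of elements and indices of pivots.

  [_<_] : Carrier → Carrier → ℕ
  [ x < y ] = if does (x <? y) then 1 else 0

  [<]-true : ∀ {x y} → x < y → 1 ℕ.≤ [ x < y ]
  [<]-true {x} {y} x<y rewrite dec-true (x <? y) x<y = ℕ.≤-refl

  [<]-asym : ∀ x y → [ x < y ] ℕ.+ [ y < x ] ℕ.≤ 1
  [<]-asym x y with x <? y | y <? x
  ... | yes x<y | yes y<x = contradiction y<x (asym x<y)
  ... | yes _   | no  _   = s≤s z≤n
  ... | no  _   | yes _   = s≤s z≤n
  ... | no  _   | no  _   = z≤n

  rank : Vector Carrier m → Fin m → ℕ
  rank xs p = sumℕ (λ q → [ xs q < xs p ])

  -- Double counting: exchanging the sums in the second copy makes it count larger elements instead
  -- of smaller ones. By asymmetry each of the m² ordered pairs then contributes at most one.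
  2*sum-rank≤m² : (xs : Vector Carrier m) → sumℕ (rank xs) ℕ.+ sumℕ (rank xs) ℕ.≤ m ℕ.* m
  2*sum-rank≤m² {m} xs = begin
    sumℕ (rank xs) ℕ.+ sumℕ (rank xs)
      ≡⟨ cong (sumℕ (rank xs) ℕ.+_) (sumℕ-comm (λ p q → [ xs q < xs p ])) ⟩
    sumℕ (rank xs) ℕ.+ sumℕ (λ q → sumℕ (λ p → [ xs q < xs p ]))
      ≡⟨ sumℕ-distrib-+ (rank xs) (λ q → sumℕ (λ p → [ xs q < xs p ])) ⟨
    sumℕ (λ p → rank xs p ℕ.+ sumℕ (λ q → [ xs p < xs q ]))
      ≡⟨ sumℕ-cong (λ p → sym (sumℕ-distrib-+ (λ q → [ xs q < xs p ]) (λ q → [ xs p < xs q ]))) ⟩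
    sumℕ (λ p → sumℕ (λ q → [ xs q < xs p ] ℕ.+ [ xs p < xs q ]))
      ≤⟨ sumℕ-mono-≤ (λ p → sumℕ-mono-≤ (λ q → [<]-asym (xs q) (xs p))) ⟩
    sumℕ {m} (λ p → sumℕ {m} (λ q → 1))
      ≡⟨ sumℕ-const m (sumℕ {m} (λ q → 1)) ⟩
    m ℕ.* sumℕ {m} (λ q → 1)
      ≡⟨ cong (m ℕ.*_) (trans (sumℕ-const m 1) (ℕ.*-identityʳ m)) ⟩
    m ℕ.* m ∎
    where open ℕ.≤-Reasoning

  -- Every position before the index holds an element smaller than the pivot, and counting smaller
  -- elements is invariant under the rearrangement.
  index≤rank : {xs : Vector Carrier m} {p : Fin m} {part : Partition m} →
               IsPartition O xs p part → toℕ (Partition.index part) ℕ.≤ rank xs p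
  index≤rank {xs = xs} {p} {part} isPart = ℕ.≤-trans
    (toℕ≤sumℕ (λ j → [ xs (rearrangement ⟨$⟩ʳ j) < xs p ]) index
      (λ j j<index → [<]-true (smaller j j<index)))
    (ℕ.≤-reflexive (sym (sumℕ-permute (λ q → [ xs q < xs p ]) rearrangement)))
    where
    open Partition part
    open IsPartition isPart

  -- The recurrence for the expected number of comparisons.

  module _ (partition : PartitionProcedure) where

    cost : Vector Carrier m → Fin m → ℕ
    cost xs p = proj₂ (run O xs (partition _ p))

    pivotIndex : Vector Carrier m → Fin m → Fin m
    pivotIndex xs p = Partition.index (proj₁ (run O xs (partition _ p)))

    left : (xs : Vector Carrier m) (p : Fin m) → Vector Carrier (toℕ (pivotIndex xs p))
    left xs p = xs ∘ (Partition.rearrangement (proj₁ (run O xs (partition _ p))) ⟨$⟩ʳ_) ∘ inject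

    -- The left part is `xs` after two injections, `inject` and a permutation. Distinctness is what
    -- lets the induction hypothesis apply to the recursive call.
    left-injective : (xs : Vector Carrier m) → Injective _≡_ _≈_ xs →
                     ∀ p → Injective _≡_ _≈_ (left xs p)
    left-injective xs inj p {i} {j} eq = toℕ-injective
      (trans (sym (toℕ-inject i))
        (trans (cong toℕ (Injection.injective (↔⇒↣ π) (inj eq))) (toℕ-inject j)))
      where π = Partition.rearrangement (proj₁ (run O xs (partition _ p)))

    -- The accessibility proof is left arbitrary so that inductions can follow the recursion of
    -- `lohify`; `expectedRuntime` is the case `<-wellFounded _`.
    expectedComparisons : Acc ℕ._<_ m → Vector Carrier m → ℚ
    expectedComparisons ac xs = 𝔼 (fromℕ ∘ Outcome.comparisons) (lohify O partition ac xs)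

    expectedComparisons-nonNegative : (ac : Acc ℕ._<_ m) (xs : Vector Carrier m) →
                                      0ℚ ≤ expectedComparisons ac xs
    expectedComparisons-nonNegative ac xs =
      𝔼-nonNegative {f = fromℕ ∘ Outcome.comparisons}
        (λ o → fromℕ-mono-≤ {n = Outcome.comparisons o} z≤n) (lohify O partition ac xs)

    -- The array entries written back are irrelevant, so the map g, whose
    -- definition is not in scope, is left to unification.
    lohify-suc : (rs : ∀ {k} → k ℕ.< suc n → Acc ℕ._<_ k) (xs : Vector Carrier (suc n)) →
      Σ (∀ p → Outcome Carrier (toℕ (pivotIndex xs p)) → Outcome Carrier (suc n)) λ g →
        lohify O partition (acc rs) xs ≡
          uniform (suc n) (λ p →
            mapᴿ (g p) (lohify O partition (rs (toℕ<n (pivotIndex xs p))) (left xs p))) ×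
        (∀ p o → Outcome.comparisons (g p o) ≡ cost xs p ℕ.+ Outcome.comparisons o)
    lohify-suc rs xs = _ , refl , λ p o → refl

    expectedComparisons-suc :
      (rs : ∀ {k} → k ℕ.< suc n → Acc ℕ._<_ k) (xs : Vector Carrier (suc n)) →
      expectedComparisons (acc rs) xs ≡
      mean (λ p → fromℕ (cost xs p) +
                  expectedComparisons (rs (toℕ<n (pivotIndex xs p))) (left xs p))
    expectedComparisons-suc {n} rs xs =
      let g , lohify≡ , comparisons-g = lohify-suc rs xs
          comparisons-+ : ∀ p o → fromℕ (Outcome.comparisons (g p o)) ≡
                                  fromℕ (cost xs p) + fromℕ (Outcome.comparisons o)
          comparisons-+ p o = trans (cong fromℕ (comparisons-g p o))
                                    (fromℕ-+ (cost xs p) (Outcome.comparisons o))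
      in trans (cong (𝔼 (fromℕ ∘ Outcome.comparisons)) lohify≡)
               (𝔼-uniform-mapᴿ-+ {f = fromℕ ∘ Outcome.comparisons} {g = g}
                                  {h = λ _ → fromℕ ∘ Outcome.comparisons} (fromℕ ∘ cost xs) comparisons-+
                 (λ p → lohify O partition (rs (toℕ<n (pivotIndex xs p))) (left xs p)))

    -- The lower bound.

    expectedComparisons-lower : ∀ {c} (ac : Acc ℕ._<_ m) (xs : Vector Carrier m) →
      (∀ p → c * fromℕ m ≤ fromℕ (cost xs p)) → c * fromℕ m ≤ expectedComparisons ac xs
    expectedComparisons-lower {zero} {c} ac xs c≤cost = ℚ.≤-reflexive (ℚ.*-zeroʳ c)
    expectedComparisons-lower {m@(suc _)} {c} (acc rs) xs c≤cost = begin
      c * fromℕ m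
        ≡⟨ mean-const {m} (c * fromℕ m) ⟨
      mean {m} (λ _ → c * fromℕ m)
        ≤⟨ mean-mono-≤ (λ p → ℚ.≤-trans (c≤cost p) (p≤p+q (fromℕ (cost xs p)) (rest p)
             {{ℚ.nonNegative (expectedComparisons-nonNegative (rs (toℕ<n (pivotIndex xs p))) (left xs p))}})) ⟩
      mean (λ p → fromℕ (cost xs p) + rest p)
        ≡⟨ expectedComparisons-suc rs xs ⟨
      expectedComparisons (acc rs) xs ∎
      where
      open ℚ.≤-Reasoning
      rest : Vector ℚ m
      rest p = expectedComparisons (rs (toℕ<n (pivotIndex xs p))) (left xs p)

    -- The upper bound, given a linear cost at every size.

    module _ (correct : Correct O partition) {K : ℚ} {{_ : NonNegative K}}
             (cost≤ : ∀ m ((xs , _) : DistinctArray O m) p → fromℕ (cost xs p) ≤ K * fromℕ m) where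

      mean-pivotIndex : .{{_ : NonZero m}} → ((xs , _) : DistinctArray O m) →
        (K + K) * mean (fromℕ ∘ toℕ ∘ pivotIndex xs) ≤ K * fromℕ m
      mean-pivotIndex {m} (xs , inj) = begin
        (K + K) * (1/m * sum (fromℕ ∘ toℕ ∘ pivotIndex xs))
          ≡⟨ cong (λ s → (K + K) * (1/m * s)) (sum-fromℕ (toℕ ∘ pivotIndex xs)) ⟩
        (K + K) * (1/m * fromℕ S)
          -- The doubled constant is traded for a doubled sum, so the bound on `S + S` applies
          -- without any halving.
          ≡⟨ solve 3 (λ k x s → (k :+ k) :* (x :* s) := k :* (x :* (s :+ s))) refl K 1/m (fromℕ S) ⟩
        K * (1/m * (fromℕ S + fromℕ S))
          ≡⟨ cong (λ s → K * (1/m * s)) (fromℕ-+ S S) ⟨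
        K * (1/m * fromℕ (S ℕ.+ S))
          ≤⟨ ℚ.*-monoˡ-≤-nonNeg K (ℚ.*-monoˡ-≤-nonNeg 1/m (fromℕ-mono-≤ 2S≤m²)) ⟩
        K * (1/m * fromℕ (m ℕ.* m))
          ≡⟨ cong (λ s → K * (1/m * s)) (fromℕ-* m m) ⟩
        K * (1/m * (fromℕ m * fromℕ m))
          ≡⟨ cong (K *_) (ℚ.*-assoc 1/m (fromℕ m) (fromℕ m)) ⟨
        K * (1/m * fromℕ m * fromℕ m)
          ≡⟨ cong (λ x → K * (x * fromℕ m)) (1/n*fromℕ-n m) ⟩
        K * (1ℚ * fromℕ m)
          ≡⟨ cong (K *_) (ℚ.*-identityˡ (fromℕ m)) ⟩
        K * fromℕ m ∎
        where
        open ℚ.≤-Reasoning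
        1/m = + 1 / m
        S = sumℕ (toℕ ∘ pivotIndex xs)
        S≤ : S ℕ.≤ sumℕ (rank xs)
        S≤ = sumℕ-mono-≤ (λ p → index≤rank (correct m (xs , inj) p))
        2S≤m² : S ℕ.+ S ℕ.≤ m ℕ.* m
        2S≤m² = ℕ.≤-trans (ℕ.+-mono-≤ S≤ S≤) (2*sum-rank≤m² xs)
        instance _ = ℚ.normalize-nonNeg 1 m

      expectedComparisons-upper : (ac : Acc ℕ._<_ m) ((xs , _) : DistinctArray O m) →
        expectedComparisons ac xs ≤ (K + K) * fromℕ m
      expectedComparisons-upper {zero} ac xs = ℚ.≤-reflexive (sym (ℚ.*-zeroʳ (K + K)))
      expectedComparisons-upper {m@(suc _)} (acc rs) (xs , inj) = begin
        expectedComparisons (acc rs) xs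
          ≡⟨ expectedComparisons-suc rs xs ⟩
        mean (λ p → fromℕ (cost xs p) + expectedComparisons (rs (toℕ<n (pivotIndex xs p))) (left xs p))
          -- The left part has size `toℕ (pivotIndex xs p)`, so the induction hypothesis is linear
          -- in the pivot index.
          ≤⟨ mean-mono-≤ (λ p → ℚ.+-mono-≤ (cost≤ m (xs , inj) p)
               (expectedComparisons-upper (rs (toℕ<n (pivotIndex xs p))) (left xs p , left-injective xs inj p))) ⟩
        mean (λ p → K * fromℕ m + (K + K) * index p)
          ≡⟨ mean-const-+ (K * fromℕ m) (λ p → (K + K) * index p) ⟩
        K * fromℕ m + mean (λ p → (K + K) * index p)
          ≡⟨ cong (λ x → K * fromℕ m + x) (mean-* (K + K) index) ⟩
        K * fromℕ m + (K + K) * mean index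
          -- This closes the induction: the recursive calls cost on average no more than the bound
          -- `K * fromℕ m` for the partition itself, which reproduces `K + K`.
          ≤⟨ ℚ.+-monoʳ-≤ (K * fromℕ m) (mean-pivotIndex (xs , inj)) ⟩
        K * fromℕ m + K * fromℕ m
          ≡⟨ ℚ.*-distribʳ-+ (fromℕ m) K K ⟨
        (K + K) * fromℕ m ∎
        where
        open ℚ.≤-Reasoning
        index : Vector ℚ m
        index = fromℕ ∘ toℕ ∘ pivotIndex xs

    -- On the finitely many sizes below n₀, where the Θ hypothesis says nothing,
    -- the depth of the decision trees bounds the cost for all arrays at once.
    depthBelow : ℕ → ℕ
    depthBelow n₀ = sumℕ {n₀} (λ i → sumℕ (λ p → depth (partition (toℕ i) p)))

    cost≤depthBelow : ∀ {n₀} → m ℕ.< n₀ → (xs : Vector Carrier m) (p : Fin m) →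
                      cost xs p ℕ.≤ depthBelow n₀
    cost≤depthBelow {m} {n₀} m<n₀ xs p = begin
      cost xs p                                    ≤⟨ run≤depth xs (partition m p) ⟩
      depth (partition m p)                        ≤⟨ term≤sumℕ (λ p → depth (partition m p)) p ⟩
      depthAt m                                    ≡⟨ cong depthAt (toℕ-fromℕ< m<n₀) ⟨
      depthAt (toℕ (fromℕ< m<n₀))                  ≤⟨ term≤sumℕ (depthAt ∘ toℕ) (fromℕ< m<n₀) ⟩
      depthBelow n₀                                ∎
      where
      open ℕ.≤-Reasoning
      depthAt : ℕ → ℕ
      depthAt m = sumℕ (λ p → depth (partition m p))

    -- The recursion descends to sizes below `n₀` even from large arrays, so the upper bound needs a
    -- linear cost at every size. Enlarging the constant by `depthBelow n₀` absorbs the small ones.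
    cost-linear : ∀ {c n₀} .{{_ : NonNegative c}} →
      (∀ m → n₀ ℕ.≤ m → ((xs , _) : DistinctArray O m) → ∀ p → fromℕ (cost xs p) ≤ c * fromℕ m) →
      ∀ m ((xs , _) : DistinctArray O m) p →
      fromℕ (cost xs p) ≤ (c + fromℕ (depthBelow n₀)) * fromℕ m
    cost-linear {c} {n₀} cost≤ m@(suc _) (xs , inj) p with n₀ ℕ.≤? m
    ... | yes n₀≤m = ℚ.≤-trans (cost≤ m n₀≤m (xs , inj) p)
      (ℚ.*-monoʳ-≤-nonNeg (fromℕ m) (p≤p+q c D))
      where
      D = fromℕ (depthBelow n₀)
      instance _ = fromℕ-nonNegative m
      instance _ = fromℕ-nonNegative (depthBelow n₀)
    ... | no n₀≰m = begin
      fromℕ (cost xs p)                       ≤⟨ fromℕ-mono-≤ (cost≤depthBelow (ℕ.≰⇒> n₀≰m) xs p) ⟩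
      -- Here `m` is at least one, because the pivot `p : Fin m` rules out the empty array.
      D                                       ≤⟨ fromℕ-mono-≤ (ℕ.m≤m*n (depthBelow n₀) m) ⟩
      fromℕ (depthBelow n₀ ℕ.* m)             ≡⟨ fromℕ-* (depthBelow n₀) m ⟩
      D * fromℕ m                             ≤⟨ ℚ.*-monoʳ-≤-nonNeg (fromℕ m) (p≤p+q D c) ⟩
      (D + c) * fromℕ m                       ≡⟨ cong (_* fromℕ m) (ℚ.+-comm D c) ⟩
      (c + D) * fromℕ m                       ∎
      where
      open ℚ.≤-Reasoning
      D = fromℕ (depthBelow n₀)
      instance _ = fromℕ-nonNegative m

theorem2p11 : ∀ {a ℓ₁ ℓ₂} (O : StrictTotalOrder a ℓ₁ ℓ₂)
    (partition : PartitionProcedure) →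
    Correct O partition →
    partitionComparisons O partition ∈Θ fromℕ →
    expectedRuntime O partition ∈Θ fromℕ
theorem2p11 O partition correct (c₁ , c₂ , n₀ , 0<c₁ , 0<c₂ , bounds) =
  -- The lower constant and the threshold are those of the partition bound. The upper constant
  -- doubles `K`, which is `c₂` plus the correction `D` for sizes below `n₀`.
  c₁ , K + K , n₀ , 0<c₁ , ℚ.positive⁻¹ (K + K) , λ n n₀≤n xs →
    expectedComparisons-lower O partition {c = c₁} (<-wellFounded n) (proj₁ xs)
      (λ p → proj₁ (bounds n n₀≤n (xs , p))) ,
    expectedComparisons-upper O partition correct {K = K}
      (cost-linear O partition {c = c₂} (λ m n₀≤m xs p → proj₂ (bounds m n₀≤m (xs , p))))
      (<-wellFounded n) xs
  where
  D = depthBelow O partition n₀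
  K = c₂ + fromℕ D
  instance
    c₂-positive = ℚ.positive 0<c₂
    c₂-nonNegative = ℚ.pos⇒nonNeg c₂
    D-nonNegative = fromℕ-nonNegative D
    K-positive = ℚ.pos+nonNeg⇒pos c₂ (fromℕ D)
    K-nonNegative = ℚ.pos⇒nonNeg K
    K+K-positive = ℚ.pos+nonNeg⇒pos K K
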